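{- Let $\mathcal{H}_+$ be the set of all quadruples $(a_0,a_1,a_2,a_3)$ of positive integers such that $H(a_0;a_1,a_2,a_3)\subset\mathcal{S}$. For all $i,j\in\{0,1,2,3\}$ with $i<j$, the set $$H_{i,j}:=\left\{\frac{a_i}{a_j} : (a_0,a_1,a_2,a_3)\in\mathcal{H}_+\right\}\subset\mathbb{Q}_+$$ is dense, in the Euclidean topology, in the set $\mathbb{R}_+$ of positive real numbers.
   Context: $\mathcal{S}=\{n^2 : n\in\mathbb{N}\}$ is the set of integer squares. The Hilbert cube of dimension $3$ is $H(a_0;a_1,a_2,a_3)=\{a_0+\varepsilon_1a_1+\varepsilon_2a_2+\varepsilon_3a_3 : \varepsilon_i\in\{0,1\}\}$. No ordering or distinctness of $a_1,a_2,a_3$ is required. -}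

module Defs where

open import Data.Empty using (⊥)
open import Data.Fin.Base using (Fin; toℕ)
open import Data.Fin.Patterns using (0F; 1F; 2F; 3F)
open import Data.Integer.Base using (+_)
open import Data.Nat.Base as ℕ using (ℕ; NonZero)
open import Data.Product using (∃-syntax; Σ-syntax; _×_; _,_; proj₁)
open import Data.Rational.Base as ℚ using (ℚ; 0ℚ; 1ℚ; _/_)
import Data.Rational.Properties as ℚ
open import Data.Sum.Base using (_⊎_; inj₁; inj₂)
open import Data.Vec.Functional using (Vector)
open import Level using (0ℓ; _⊔_) renaming (suc to lsuc)
open import Relation.Binary.Definitions using (tri<; tri≈; tri>)
open import Relation.Binary.PropositionalEquality using (_≡_; refl; subst)
open import Relation.Unary using (Pred; _∈_; _⊆_; _≐_)

-- Real numbers as (located, two-sided) Dedekind cuts of ℚ.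

record ℝ : Set₁ where
  field
    lower upper     : Pred ℚ 0ℓ
    lower-inhabited : ∃[ q ] q ∈ lower
    upper-inhabited : ∃[ q ] q ∈ upper
    lower-closed    : ∀ {p q} → p ℚ.< q → q ∈ lower → p ∈ lower
    upper-closed    : ∀ {p q} → p ℚ.< q → p ∈ upper → q ∈ upper
    lower-open      : ∀ {p} → p ∈ lower → ∃[ q ] p ℚ.< q × q ∈ lower
    upper-open      : ∀ {q} → q ∈ upper → ∃[ p ] p ℚ.< q × p ∈ upper
    disjoint        : ∀ {q} → q ∈ lower → q ∈ upper → ⊥
    located         : ∀ {p q} → p ℚ.< q → p ∈ lower ⊎ q ∈ upper

open ℝ public

infix 4 _≈_ _<_

_≈_ : ℝ → ℝ → Set
x ≈ y = lower x ≐ lower y × upper x ≐ upper y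

_<_ : ℝ → ℝ → Set
x < y = ∃[ q ] q ∈ upper x × q ∈ lower y

fromℚ : ℚ → ℝ
fromℚ r = record
  { lower           = λ q → q ℚ.< r
  ; upper           = λ q → r ℚ.< q
  ; lower-inhabited = r ℚ.- 1ℚ , subst (r ℚ.- 1ℚ ℚ.<_) (ℚ.+-identityʳ r)
                        (ℚ.+-monoʳ-< r (ℚ.negative⁻¹ (ℚ.- 1ℚ)))
  ; upper-inhabited = r ℚ.+ 1ℚ , subst (ℚ._< r ℚ.+ 1ℚ) (ℚ.+-identityʳ r)
                        (ℚ.+-monoʳ-< r (ℚ.positive⁻¹ 1ℚ))
  ; lower-closed    = ℚ.<-trans
  ; upper-closed    = λ p<q r<p → ℚ.<-trans r<p p<q
  ; lower-open      = ℚ.<-dense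
  ; upper-open      = λ r<q → let m , r<m , m<q = ℚ.<-dense r<q in m , m<q , r<m
  ; disjoint        = ℚ.<-asym
  ; located         = fromℚ-located
  }
  where
  fromℚ-located : ∀ {p q} → p ℚ.< q → p ℚ.< r ⊎ r ℚ.< q
  fromℚ-located {p} p<q with ℚ.<-cmp p r
  ... | tri< p<r _ _  = inj₁ p<r
  ... | tri≈ _ refl _ = inj₂ p<q
  ... | tri> _ _ r<p  = inj₂ (ℚ.<-trans r<p p<q)

ℝ₊ : Pred ℝ 0ℓ
ℝ₊ x = fromℚ 0ℚ < x

-- The Euclidean topology on ℝ, generated by the open intervals.  An open set
-- automatically respects _≈_, since the order does.

Open : ∀ {ℓ} → Pred ℝ ℓ → Set (lsuc 0ℓ ⊔ ℓ)
Open U = ∀ {x} → x ∈ U →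
  ∃[ l ] ∃[ u ] l < x × x < u × (∀ {y} → l < y → y < u → y ∈ U)

-- The open sets of the subspace X are the traces U ∩ X, so D ⊆ X is dense in X
-- when D meets every open U that meets X.  Level 1 is the level of ℝ; sets at
-- level 0 are included by lifting.

DenseIn : Pred ℝ 0ℓ → Pred ℝ 0ℓ → Set₂
DenseIn D X = D ⊆ X ×
  ((U : Pred ℝ (lsuc 0ℓ)) → Open U →
    (∃[ x ] x ∈ X × x ∈ U) → ∃[ d ] d ∈ D × d ∈ U)

inℝ : Pred ℚ 0ℓ → Pred ℝ 0ℓ
inℝ D x = ∃[ q ] q ∈ D × x ≈ fromℚ q

𝒮 : Pred ℕ 0ℓ
𝒮 n = ∃[ m ] n ≡ m ℕ.^ 2

-- The Hilbert cube H(a₀; a₁, a₂, a₃), with ε ranging over {0,1}³.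

H : ℕ → ℕ → ℕ → ℕ → Pred ℕ 0ℓ
H a₀ a₁ a₂ a₃ n = Σ[ ε₁ ∈ Fin 2 ] Σ[ ε₂ ∈ Fin 2 ] Σ[ ε₃ ∈ Fin 2 ]
  n ≡ a₀ ℕ.+ toℕ ε₁ ℕ.* a₁ ℕ.+ toℕ ε₂ ℕ.* a₂ ℕ.+ toℕ ε₃ ℕ.* a₃

𝓗₊ : Pred (Vector ℕ 4) 0ℓ
𝓗₊ a = (∀ k → NonZero (a k)) × H (a 0F) (a 1F) (a 2F) (a 3F) ⊆ 𝒮

H[_,_] : Fin 4 → Fin 4 → Pred ℚ 0ℓ
H[ i , j ] q = Σ[ a ∈ Vector ℕ 4 ] Σ[ a∈𝓗₊ ∈ a ∈ 𝓗₊ ]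
  q ≡ (+ a i / a j) {{proj₁ a∈𝓗₊ j}}

{-# OPTIONS --safe #-}
module Submission where

open import Defs hiding (_<_; _≈_)
open import Data.Fin.Base as Fin using (Fin; toℕ)
open import Data.Fin.Patterns using (0F; 1F; 2F; 3F)
open import Data.Integer.Base as ℤ using (ℤ; +_; -[1+_]; +[1+_]; +0; 0ℤ)
  renaming (_+_ to _⊕_; _-_ to _⊖_; _*_ to _⊛_)
import Data.Integer.Properties as ℤ
import Data.Integer.Tactic.RingSolver as ℤ
open import Data.Nat.Base as ℕ using (ℕ; zero; suc)
import Data.Nat.Divisibility as ℕ
import Data.Nat.Primality as ℕ
import Data.Nat.Properties as ℕ
import Data.Nat.Tactic.RingSolver as ℕ
open import Data.Product using (∃-syntax; _×_; _,_; proj₁; proj₂)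
open import Data.Rational.Base
open import Data.Rational.Properties
open import Data.Rational.Solver using (module +-*-Solver)
import Data.Rational.Unnormalised.Base as ℚᵘ
import Data.Rational.Unnormalised.Properties as ℚᵘ
open import Data.Sum.Base using (inj₁; inj₂; reduce)
open import Data.Vec.Functional using ([]; _∷_)
open import Relation.Binary.Definitions using (tri<; tri≈; tri>)
open import Relation.Binary.PropositionalEquality
open import Relation.Nullary using (yes; no; contradiction)
open import Relation.Nullary.Decidable using (toWitness)
import Relation.Unary as U
open +-*-Solver

-- Cubes are sought in the degenerate shape a₀ , D , D , e, where both
-- a₀ , a₀ + D , a₀ + 2D and their translates by e are progressions of three
-- squares.  A rational t = M / N gives, through a Pythagorean triple, a
-- progression of squares whose middle term X and step d have ratio
-- s = half-sum (half-difference t); on the congruent-number curve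
-- y² = x³ - d²x this is a point with abscissa X.  Duplication of the point
-- yields another progression of squares with step d and middle-to-step ratio
-- s′ = half-sum (half-difference s).  Taking the new progression as the
-- bottom of the cube and the old one as the top gives
-- a₀ / D = s′ - 1 and e / D = s - s′.
--
-- Both quantities are composites of functions that climb, with bounded slope,
-- from a small value to infinity, so walking along a fine arithmetic
-- progression hits every interval; up to a permutation of the aᵢ these two
-- ratios account for all six pairs.

-- Signs, differences and reciprocals of rationals.

private variable p q x y c : ℚ

0<1 : 0ℚ < 1ℚ
0<1 = positive⁻¹ 1ℚ

0≤1 : 0ℚ ≤ 1ℚ
0≤1 = <⇒≤ 0<1

+-nonneg : 0ℚ ≤ p → 0ℚ ≤ q → 0ℚ ≤ p + q
+-nonneg = +-mono-≤

+-pos : 0ℚ < p → 0ℚ ≤ q → 0ℚ < p + q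
+-pos = +-mono-<-≤

*-nonneg : 0ℚ ≤ p → 0ℚ ≤ q → 0ℚ ≤ p * q
*-nonneg {p} {q} 0≤p 0≤q =
  nonNegative⁻¹ (p * q) {{nonNeg*nonNeg⇒nonNeg p {{nonNegative 0≤p}} q {{nonNegative 0≤q}}}}

*-pos : 0ℚ < p → 0ℚ < q → 0ℚ < p * q
*-pos {p} {q} 0<p 0<q =
  positive⁻¹ (p * q) {{pos*pos⇒pos p {{positive 0<p}} q {{positive 0<q}}}}

p+[q-p]≡q : ∀ p q → p + (q - p) ≡ q
p+[q-p]≡q = solve 2 (λ p q → p :+ (q :- p) := q) refl

0≤q-p⇒p≤q : 0ℚ ≤ q - p → p ≤ q
0≤q-p⇒p≤q {q} {p} h = subst₂ _≤_ (+-identityʳ p) (p+[q-p]≡q p q) (+-monoʳ-≤ p h)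

0<q-p⇒p<q : 0ℚ < q - p → p < q
0<q-p⇒p<q {q} {p} h = subst₂ _<_ (+-identityʳ p) (p+[q-p]≡q p q) (+-monoʳ-< p h)

p≤q⇒0≤q-p : p ≤ q → 0ℚ ≤ q - p
p≤q⇒0≤q-p {p} {q} h = subst (_≤ q - p) (+-inverseʳ p) (+-monoˡ-≤ (- p) h)

p<q⇒0<q-p : p < q → 0ℚ < q - p
p<q⇒0<q-p {p} {q} h = subst (_< q - p) (+-inverseʳ p) (+-monoˡ-< (- p) h)

-- Total reciprocal, with 0 ⁻¹ = 0.
infix 8 _⁻¹
_⁻¹ : ℚ → ℚ
mkℚ +0 _ _ ⁻¹ = 0ℚ
p@(mkℚ +[1+ _ ] _ _) ⁻¹ = 1/ p
p@(mkℚ -[1+ _ ] _ _) ⁻¹ = 1/ p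

⁻¹-inverseʳ : 0ℚ < p → p * p ⁻¹ ≡ 1ℚ
⁻¹-inverseʳ {mkℚ +0 _ _} (*<* (ℤ.+<+ ()))
⁻¹-inverseʳ {p@(mkℚ +[1+ _ ] _ _)} _ = *-inverseʳ p
⁻¹-inverseʳ {p@(mkℚ -[1+ _ ] _ _)} _ = *-inverseʳ p

⁻¹-inverseˡ : 0ℚ < p → p ⁻¹ * p ≡ 1ℚ
⁻¹-inverseˡ {p} 0<p = trans (*-comm (p ⁻¹) p) (⁻¹-inverseʳ 0<p)

⁻¹-pos : 0ℚ < p → 0ℚ < p ⁻¹
⁻¹-pos {mkℚ +0 _ _} (*<* (ℤ.+<+ ()))
⁻¹-pos {p@(mkℚ +[1+ _ ] _ _)} _ = positive⁻¹ (1/ p)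

-- The embedding of the integers and the Archimedean property.

ι : ℤ → ℚ
ι i = i / 1

toℚᵘ-ι : ∀ i → toℚᵘ (ι i) ℚᵘ.≃ ℚᵘ.mkℚᵘ i 0
toℚᵘ-ι i = toℚᵘ-fromℚᵘ (ℚᵘ.mkℚᵘ i 0)

ι-+ : ∀ i j → ι (i ⊕ j) ≡ ι i + ι j
ι-+ i j = toℚᵘ-injective (begin
  toℚᵘ (ι (i ⊕ j))              ≈⟨ toℚᵘ-ι (i ⊕ j) ⟩
  ℚᵘ.mkℚᵘ (i ⊕ j) 0
    ≈⟨ ℚᵘ.*≡* (cong (_⊛ + 1) (sym (cong₂ _⊕_ (ℤ.*-identityʳ i) (ℤ.*-identityʳ j)))) ⟩
  ℚᵘ.mkℚᵘ i 0 ℚᵘ.+ ℚᵘ.mkℚᵘ j 0  ≈⟨ ℚᵘ.+-cong (toℚᵘ-ι i) (toℚᵘ-ι j) ⟨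
  toℚᵘ (ι i) ℚᵘ.+ toℚᵘ (ι j)    ≈⟨ toℚᵘ-homo-+ (ι i) (ι j) ⟨
  toℚᵘ (ι i + ι j)              ∎)
  where open ℚᵘ.≃-Reasoning

ι-* : ∀ i j → ι (i ⊛ j) ≡ ι i * ι j
ι-* i j = toℚᵘ-injective (begin
  toℚᵘ (ι (i ⊛ j))              ≈⟨ toℚᵘ-ι (i ⊛ j) ⟩
  ℚᵘ.mkℚᵘ i 0 ℚᵘ.* ℚᵘ.mkℚᵘ j 0  ≈⟨ ℚᵘ.*-cong (toℚᵘ-ι i) (toℚᵘ-ι j) ⟨
  toℚᵘ (ι i) ℚᵘ.* toℚᵘ (ι j)    ≈⟨ toℚᵘ-homo-* (ι i) (ι j) ⟨
  toℚᵘ (ι i * ι j)              ∎)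
  where open ℚᵘ.≃-Reasoning

ι-neg : ∀ i → ι (ℤ.- i) ≡ - ι i
ι-neg i = toℚᵘ-injective (begin
  toℚᵘ (ι (ℤ.- i))  ≈⟨ toℚᵘ-ι (ℤ.- i) ⟩
  ℚᵘ.- ℚᵘ.mkℚᵘ i 0  ≈⟨ ℚᵘ.-‿cong (toℚᵘ-ι i) ⟨
  ℚᵘ.- toℚᵘ (ι i)   ≈⟨ toℚᵘ-homo‿- (ι i) ⟨
  toℚᵘ (- ι i)      ∎)
  where open ℚᵘ.≃-Reasoning

ι-mono-≤ : ∀ {i j} → i ℤ.≤ j → ι i ≤ ι j
ι-mono-≤ {i} {j} i≤j = toℚᵘ-cancel-≤
  (ℚᵘ.≤-respˡ-≃ (ℚᵘ.≃-sym (toℚᵘ-ι i)) (ℚᵘ.≤-respʳ-≃ (ℚᵘ.≃-sym (toℚᵘ-ι j))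
    (ℚᵘ.*≤* (ℤ.*-monoʳ-≤-nonNeg (+ 1) i≤j))))

ι-mono-< : ∀ {i j} → i ℤ.< j → ι i < ι j
ι-mono-< {i} {j} i<j = toℚᵘ-cancel-<
  (ℚᵘ.<-respˡ-≃ (ℚᵘ.≃-sym (toℚᵘ-ι i)) (ℚᵘ.<-respʳ-≃ (ℚᵘ.≃-sym (toℚᵘ-ι j))
    (ℚᵘ.*<* (ℤ.*-monoʳ-<-pos (+ 1) i<j))))

ι-cancel-< : ∀ {i j} → ι i < ι j → i ℤ.< j
ι-cancel-< ιi<ιj = ℤ.≰⇒> λ j≤i → <-irrefl refl (<-≤-trans ιi<ιj (ι-mono-≤ j≤i))

[i/n]*ιn≡ιi : ∀ i n .{{_ : ℕ.NonZero n}} → (i / n) * ι (+ n) ≡ ι i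
[i/n]*ιn≡ιi i n@(suc n-1) = toℚᵘ-injective (begin
  toℚᵘ (i / n * ι (+ n))            ≈⟨ toℚᵘ-homo-* (i / n) (ι (+ n)) ⟩
  toℚᵘ (i / n) ℚᵘ.* toℚᵘ (ι (+ n))  ≈⟨ ℚᵘ.*-cong (toℚᵘ-fromℚᵘ (ℚᵘ.mkℚᵘ i n-1)) (toℚᵘ-ι (+ n)) ⟩
  ℚᵘ.mkℚᵘ i n-1 ℚᵘ.* ℚᵘ.mkℚᵘ (+ n) 0
    ≈⟨ ℚᵘ.*≡* (trans (ℤ.*-identityʳ (i ⊛ + n)) (cong (i ⊛_) (cong +_ (sym (ℕ.*-identityʳ n))))) ⟩
  ℚᵘ.mkℚᵘ i 0                       ≈⟨ toℚᵘ-ι i ⟨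
  toℚᵘ (ι i)                        ∎)
  where open ℚᵘ.≃-Reasoning

p≤ι∣↥p∣ : ∀ p → p ≤ ι (+ ℤ.∣ ↥ p ∣)
p≤ι∣↥p∣ p@(mkℚ i d-1 _) = toℚᵘ-cancel-≤ (ℚᵘ.≤-respʳ-≃ (ℚᵘ.≃-sym (toℚᵘ-ι (+ ℤ.∣ i ∣))) (ℚᵘ.*≤* (bound i)))
  where
  bound : ∀ i → i ⊛ + 1 ℤ.≤ + ℤ.∣ i ∣ ⊛ + suc d-1
  bound (+ n)    = subst₂ ℤ._≤_ (sym (ℤ.*-identityʳ (+ n))) (ℤ.pos-* n (suc d-1))
    (ℤ.+≤+ (ℕ.m≤m*n n (suc d-1)))
  bound -[1+ n ] = ℤ.-≤+

-- A fraction is at most the absolute value of its numerator; this is applied to p / δ.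
archimedean : ∀ p {δ} → 0ℚ < δ → ∃[ n ] p ≤ ι (+ n) * δ
archimedean p {δ} 0<δ = n ,
  subst (_≤ ι (+ n) * δ) p≡ (*-monoʳ-≤-nonNeg δ {{nonNegative (<⇒≤ 0<δ)}} (p≤ι∣↥p∣ (p * δ ⁻¹)))
  where
  n = ℤ.∣ ↥ (p * δ ⁻¹) ∣
  p≡ : p * δ ⁻¹ * δ ≡ p
  p≡ = trans (*-assoc p (δ ⁻¹) δ) (trans (cong (p *_) (⁻¹-inverseˡ 0<δ)) (*-identityʳ p))

-- Hitting intervals by a discrete search.

-- Descends from `n` for as long as `f` stays above `p`; the first failure is the crossing.
crossing : ∀ (f : ℕ → ℚ) n → f 0 ≤ p → p < f n → ∃[ k ] f k ≤ p × p < f (suc k)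
crossing f zero    f0≤p p<f0 = contradiction (<-≤-trans p<f0 f0≤p) (<-irrefl refl)
crossing {p} f (suc n) f0≤p p<fsn with p <? f n
... | yes p<fn = crossing f n f0≤p p<fn
... | no  p≮fn = n , ≮⇒≥ p≮fn , p<fsn

-- `growth` says, without division, that g x is at least (x - offset) / 2, so `g` is unbounded. One
-- half is the asymptotic slope of both `half-sum` and `half-difference`.
record Climbing (g : ℚ → ℚ) (a : ℚ) : Set where
  field
    slope offset : ℚ
    slope≥0      : 0ℚ ≤ slope
    monotone     : a ≤ x → x ≤ y → g x ≤ g y
    lipschitz    : a ≤ x → x ≤ y → g y ≤ g x + slope * (y - x)
    growth       : a ≤ x → x ≤ offset + (g x + g x)

-- Abstract, here and below: if the witnesses of the search unfold, checking
-- the nested searches becomes infeasible.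
abstract
  attains : ∀ {g a} → Climbing g a → g a ≤ p → p < q →
    ∃[ l ] ∃[ r ] a ≤ l × l < r × (∀ {x} → l ≤ x → x ≤ r → p < g x × g x < q)
  attains {p} {q} {g} {a} climbing ga≤p p<q =
    node (suc k) , node (suc k) + δ , a≤node (suc k) , node<node+δ (suc k) ,
    λ l≤x x≤r → <-≤-trans p<fsk (monotone (a≤node (suc k)) l≤x) , below-q l≤x x≤r
    where
    open Climbing climbing
    -- With δ = (q - p) / w, the rise of `g` over two steps, at most 2 slope δ, falls short of q - p
    -- by exactly δ. Two steps reach from the last node with value at most `p` to the right end of
    -- the returned interval.
    w : ℚ
    w = 1ℚ + (slope + slope)
    0<w : 0ℚ < w
    0<w = +-pos 0<1 (+-nonneg slope≥0 slope≥0)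
    δ : ℚ
    δ = (q - p) * w ⁻¹
    0<δ : 0ℚ < δ
    0<δ = *-pos (p<q⇒0<q-p p<q) (⁻¹-pos 0<w)
    node : ℕ → ℚ
    node k = a + ι (+ k) * δ
    node-suc : ∀ k → node (suc k) ≡ node k + δ
    node-suc k = trans (cong (λ i → a + i * δ) (ι-+ (+ 1) (+ k)))
      (solve 3 (λ a i δ → a :+ (con 1ℚ :+ i) :* δ := a :+ i :* δ :+ δ) refl a (ι (+ k)) δ)
    a≤node : ∀ k → a ≤ node k
    a≤node k = subst (_≤ node k) (+-identityʳ a)
      (+-monoʳ-≤ a (*-nonneg (ι-mono-≤ {+ 0} {+ k} (ℤ.+≤+ ℕ.z≤n)) (<⇒≤ 0<δ)))
    node<node+δ : ∀ k → node k < node k + δ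
    node<node+δ k = subst (_< node k + δ) (+-identityʳ (node k)) (+-monoʳ-< (node k) 0<δ)
    -- The summand 1 puts `node n` strictly above offset + 2p, so `growth` forces `g (node n)` above
    -- `p`.
    N : ∃[ n ] (1ℚ + (offset + (p + p))) - a ≤ ι (+ n) * δ
    N = archimedean _ 0<δ
    n : ℕ
    n = proj₁ N
    p<fn : p < g (node n)
    p<fn = ≰⇒> λ fn≤p → <-irrefl refl (begin-strict
      offset + (p + p)                    ≡⟨ +-identityˡ _ ⟨
      0ℚ + (offset + (p + p))             <⟨ +-monoˡ-< (offset + (p + p)) 0<1 ⟩
      1ℚ + (offset + (p + p))             ≡⟨ p+[q-p]≡q a _ ⟨
      a + (1ℚ + (offset + (p + p)) - a)   ≤⟨ +-monoʳ-≤ a (proj₂ N) ⟩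
      node n                              ≤⟨ growth (a≤node n) ⟩
      offset + (g (node n) + g (node n))  ≤⟨ +-monoʳ-≤ offset (+-mono-≤ fn≤p fn≤p) ⟩
      offset + (p + p)                    ∎)
      where open ≤-Reasoning
    f0≤p : g (node 0) ≤ p
    f0≤p = subst (λ x → g x ≤ p) (sym (trans (cong (λ z → a + z) (*-zeroˡ δ)) (+-identityʳ a))) ga≤p
    crossed : ∃[ k ] g (node k) ≤ p × p < g (node (suc k))
    crossed = crossing (λ k → g (node k)) n f0≤p p<fn
    k : ℕ
    k = proj₁ crossed
    p<fsk : p < g (node (suc k))
    p<fsk = proj₂ (proj₂ crossed)
    wδ≡q-p : w * δ ≡ q - p
    wδ≡q-p = trans (solve 3 (λ w d w′ → w :* (d :* w′) := d :* (w :* w′)) refl w (q - p) (w ⁻¹))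
      (trans (cong ((q - p) *_) (⁻¹-inverseʳ 0<w)) (*-identityʳ (q - p)))
    below-q : node (suc k) ≤ x → x ≤ node (suc k) + δ → g x < q
    below-q {x} l≤x x≤r = begin-strict
      g x                       ≤⟨ lipschitz (a≤node k) node≤x ⟩
      g (node k) + slope * (x - node k)
        ≤⟨ +-mono-≤ (proj₁ (proj₂ crossed)) (*-monoˡ-≤-nonNeg slope {{nonNegative slope≥0}} x-node≤) ⟩
      p + slope * (δ + δ)       ≡⟨ +-identityʳ _ ⟨
      p + slope * (δ + δ) + 0ℚ  <⟨ +-monoʳ-< (p + slope * (δ + δ)) 0<δ ⟩
      p + slope * (δ + δ) + δ
        ≡⟨ solve 3 (λ p s δ → p :+ s :* (δ :+ δ) :+ δ := p :+ (con 1ℚ :+ (s :+ s)) :* δ) refl p slope δ ⟩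
      p + w * δ                 ≡⟨ cong (λ x → p + x) wδ≡q-p ⟩
      p + (q - p)               ≡⟨ p+[q-p]≡q p q ⟩
      q                         ∎
      where
      open ≤-Reasoning
      node≤x : node k ≤ x
      node≤x = ≤-trans (<⇒≤ (node<node+δ k)) (subst (_≤ x) (node-suc k) l≤x)
      x-node≤ : x - node k ≤ δ + δ
      x-node≤ = subst (x - node k ≤_)
        (trans (cong (λ z → z + δ - node k) (node-suc k))
               (solve 2 (λ y δ → y :+ δ :+ δ :- y := δ :+ δ) refl (node k) δ))
        (+-monoˡ-≤ (- node k) x≤r)

-- The functions behind the two ratios, and their climbing.

-- At M / N the values are (M² + N²) / 2MN and (M² - N²) / 2MN: the hypotenuse and one leg of a
-- Pythagorean triangle, each over the other leg.
half-sum half-difference : ℚ → ℚ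
half-sum x = ½ * (x + x ⁻¹)
half-difference x = ½ * (x - x ⁻¹)

-- Splits an inequality into a visibly nonnegative expression and a ring identity for the solver.
≤-by-difference : ∀ {d} → 0ℚ ≤ d → d ≡ q - p → p ≤ q
≤-by-difference 0≤d refl = 0≤q-p⇒p≤q 0≤d

½*-nonneg : 0ℚ ≤ p → 0ℚ ≤ ½ * p
½*-nonneg = *-nonneg (nonNegative⁻¹ ½)

⁻¹-difference : 0ℚ < x → 0ℚ < y → x ⁻¹ * y ⁻¹ * (y - x) ≡ x ⁻¹ - y ⁻¹
⁻¹-difference {x} {y} 0<x 0<y = begin
  x ⁻¹ * y ⁻¹ * (y - x)
    ≡⟨ solve 4 (λ x y x′ y′ → x′ :* y′ :* (y :- x)
         := x′ :* (y :* y′) :- y′ :* (x :* x′))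
       refl x y (x ⁻¹) (y ⁻¹) ⟩
  x ⁻¹ * (y * y ⁻¹) - y ⁻¹ * (x * x ⁻¹)
    ≡⟨ cong₂ (λ u v → x ⁻¹ * u - y ⁻¹ * v) (⁻¹-inverseʳ 0<y) (⁻¹-inverseʳ 0<x) ⟩
  x ⁻¹ * 1ℚ - y ⁻¹ * 1ℚ  ≡⟨ cong₂ _-_ (*-identityʳ (x ⁻¹)) (*-identityʳ (y ⁻¹)) ⟩
  x ⁻¹ - y ⁻¹            ∎
  where open ≡-Reasoning

⁻¹-antitone : 0ℚ < x → x ≤ y → y ⁻¹ ≤ x ⁻¹
⁻¹-antitone 0<x x≤y = ≤-by-difference
  (*-nonneg (<⇒≤ (*-pos (⁻¹-pos 0<x) (⁻¹-pos 0<y))) (p≤q⇒0≤q-p x≤y)) (⁻¹-difference 0<x 0<y)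
  where 0<y = <-≤-trans 0<x x≤y

⁻¹-upper : 0ℚ < x → 1ℚ ≤ x * c → x ⁻¹ ≤ c
⁻¹-upper {x} {c} 0<x 1≤xc = ≤-by-difference
  (*-nonneg (<⇒≤ (⁻¹-pos 0<x)) (p≤q⇒0≤q-p 1≤xc))
  (trans (solve 3 (λ x x′ c → x′ :* (x :* c :- con 1ℚ) := x :* x′ :* c :- x′) refl x (x ⁻¹) c)
    (trans (cong (λ u → u * c - x ⁻¹) (⁻¹-inverseʳ 0<x)) (cong (_- x ⁻¹) (*-identityˡ c))))

*-mono-≤-nonneg : ∀ {p q r s} → 0ℚ ≤ p → p ≤ q → 0ℚ ≤ r → r ≤ s → p * r ≤ q * s
*-mono-≤-nonneg {p} {q} {r} {s} 0≤p p≤q 0≤r r≤s = ≤-trans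
  (*-monoʳ-≤-nonNeg r {{nonNegative 0≤r}} p≤q)
  (*-monoˡ-≤-nonNeg q {{nonNegative (≤-trans 0≤p p≤q)}} r≤s)

-- The difference of the reciprocals is their product times y - x, and 1 ≤ x * c bounds both of them
-- by c.
⁻¹-lipschitz : 0ℚ < x → x ≤ y → 1ℚ ≤ x * c → x ⁻¹ - y ⁻¹ ≤ c * c * (y - x)
⁻¹-lipschitz {x} {y} {c} 0<x x≤y 1≤xc = subst (_≤ c * c * (y - x)) (⁻¹-difference 0<x 0<y)
  (*-monoʳ-≤-nonNeg (y - x) {{nonNegative (p≤q⇒0≤q-p x≤y)}}
    (*-mono-≤-nonneg (<⇒≤ (⁻¹-pos 0<x)) x⁻¹≤c (<⇒≤ (⁻¹-pos 0<y)) (≤-trans (⁻¹-antitone 0<x x≤y) x⁻¹≤c)))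
  where
  0<y = <-≤-trans 0<x x≤y
  x⁻¹≤c = ⁻¹-upper 0<x 1≤xc

1≤x⇒x⁻¹≤1 : 1ℚ ≤ x → x ⁻¹ ≤ 1ℚ
1≤x⇒x⁻¹≤1 {x} 1≤x = ⁻¹-upper (<-≤-trans 0<1 1≤x) (subst (1ℚ ≤_) (sym (*-identityʳ x)) 1≤x)

⁻¹-nonexpansive : 1ℚ ≤ x → x ≤ y → x ⁻¹ - y ⁻¹ ≤ y - x
⁻¹-nonexpansive {x} {y} 1≤x x≤y = subst (x ⁻¹ - y ⁻¹ ≤_) (*-identityˡ (y - x))
  (⁻¹-lipschitz (<-≤-trans 0<1 1≤x) x≤y (subst (1ℚ ≤_) (sym (*-identityʳ x)) 1≤x))

-- From 1 on, the reciprocal falls by no more than its argument rises, which gives monotonicity;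
-- that it does fall gives the Lipschitz bound.
half-sum-climbing : Climbing half-sum 1ℚ
half-sum-climbing = record
  { slope     = 1ℚ
  ; offset    = 0ℚ
  ; slope≥0   = 0≤1
  ; monotone  = λ {x} {y} 1≤x x≤y → ≤-by-difference
      (½*-nonneg (p≤q⇒0≤q-p (⁻¹-nonexpansive 1≤x x≤y)))
      (solve 4 (λ x y x′ y′ → con ½ :* (y :- x :- (x′ :- y′))
          := con ½ :* (y :+ y′) :- con ½ :* (x :+ x′))
        refl x y (x ⁻¹) (y ⁻¹))
  ; lipschitz = λ {x} {y} 1≤x x≤y → ≤-by-difference
      (½*-nonneg (+-nonneg (p≤q⇒0≤q-p x≤y) (p≤q⇒0≤q-p (⁻¹-antitone (<-≤-trans 0<1 1≤x) x≤y))))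
      (solve 4 (λ x y x′ y′ → con ½ :* (y :- x :+ (x′ :- y′))
          := con ½ :* (x :+ x′) :+ con 1ℚ :* (y :- x) :- con ½ :* (y :+ y′))
        refl x y (x ⁻¹) (y ⁻¹))
  ; growth    = λ {x} 1≤x → ≤-by-difference
      (<⇒≤ (⁻¹-pos (<-≤-trans 0<1 1≤x)))
      (solve 2 (λ x x′ → x′ := con 0ℚ :+ (con ½ :* (x :+ x′) :+ con ½ :* (x :+ x′)) :- x) refl x (x ⁻¹))
  }

-- The two facts about the reciprocal exchange roles, and x⁻¹ ≤ 1 accounts for the offset.
half-difference-climbing : Climbing half-difference 1ℚ
half-difference-climbing = record
  { slope     = 1ℚ
  ; offset    = 1ℚ
  ; slope≥0   = 0≤1
  ; monotone  = λ {x} {y} 1≤x x≤y → ≤-by-difference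
      (½*-nonneg (+-nonneg (p≤q⇒0≤q-p x≤y) (p≤q⇒0≤q-p (⁻¹-antitone (<-≤-trans 0<1 1≤x) x≤y))))
      (solve 4 (λ x y x′ y′ → con ½ :* (y :- x :+ (x′ :- y′))
          := con ½ :* (y :- y′) :- con ½ :* (x :- x′))
        refl x y (x ⁻¹) (y ⁻¹))
  ; lipschitz = λ {x} {y} 1≤x x≤y → ≤-by-difference
      (½*-nonneg (p≤q⇒0≤q-p (⁻¹-nonexpansive 1≤x x≤y)))
      (solve 4 (λ x y x′ y′ → con ½ :* (y :- x :- (x′ :- y′))
          := con ½ :* (x :- x′) :+ con 1ℚ :* (y :- x) :- con ½ :* (y :- y′))
        refl x y (x ⁻¹) (y ⁻¹))
  ; growth    = λ {x} 1≤x → ≤-by-difference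
      (p≤q⇒0≤q-p (1≤x⇒x⁻¹≤1 1≤x))
      (solve 2 (λ x x′ → con 1ℚ :- x′
          := con 1ℚ :+ (con ½ :* (x :- x′) :+ con ½ :* (x :- x′)) :- x)
        refl x (x ⁻¹))
  }

gap : ℚ → ℚ
gap s = s - half-sum (half-difference s)

-- The zero of gap lies slightly above 7/5.
7/5 : ℚ
7/5 = + 7 / 5

half-difference<id : 0ℚ < x → half-difference x < x
half-difference<id {x} 0<x = 0<q-p⇒p<q (subst (0ℚ <_)
  (solve 2 (λ x x′ → con ½ :* (x :+ x′) := x :- con ½ :* (x :- x′)) refl x (x ⁻¹))
  (*-pos (positive⁻¹ ½) (+-pos 0<x (<⇒≤ (⁻¹-pos 0<x)))))

1≤7/5 : 1ℚ ≤ 7/5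
1≤7/5 = toWitness {a? = 1ℚ ≤? 7/5} _

half-difference-7/5≤ : 7/5 ≤ x → half-difference 7/5 ≤ half-difference x
half-difference-7/5≤ = Climbing.monotone half-difference-climbing 1≤7/5

half-difference-positive : 7/5 ≤ x → 0ℚ < half-difference x
half-difference-positive 7/5≤x =
  <-≤-trans (toWitness {a? = 0ℚ <? half-difference 7/5} _) (half-difference-7/5≤ 7/5≤x)

-- With v = half-difference x, `gap x` is half the sum of x, x - v and - v⁻¹, each nondecreasing.
-- Growth follows from v < x and v⁻¹ ≤ 3.
gap-climbing : Climbing gap 7/5
gap-climbing = record
  { slope     = + 10 / 1
  ; offset    = 3ℚ
  ; slope≥0   = nonNegative⁻¹ (+ 10 / 1)
  ; monotone  = λ {x} {y} a≤x x≤y → let 1≤x = ≤-trans 1≤7/5 a≤x in ≤-by-difference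
      (½*-nonneg (+-nonneg (+-nonneg (p≤q⇒0≤q-p x≤y) (p≤q⇒0≤q-p (hd.lipschitz 1≤x x≤y)))
        (p≤q⇒0≤q-p (⁻¹-antitone (half-difference-positive a≤x) (hd.monotone 1≤x x≤y)))))
      (solve 6 (λ x y v w v′ w′ → con ½ :* (y :- x :+ (v :+ con 1ℚ :* (y :- x) :- w) :+ (v′ :- w′))
         := y :- con ½ :* (w :+ w′) :- (x :- con ½ :* (v :+ v′)))
       refl x y (hd x) (hd y) (hd x ⁻¹) (hd y ⁻¹))
  -- With v and w the half-differences of x and y, v⁻¹ - w⁻¹ is at most 9 (w - v). The slack terms
  -- carry the coefficients 18 and 10 so that w - v is left with 9 - 18 + 10 = 1, and y - x with 18
  -- / 2 = 10 - 1.
  ; lipschitz = λ {x} {y} a≤x x≤y → let 1≤x = ≤-trans 1≤7/5 a≤x in ≤-by-difference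
      (½*-nonneg (+-nonneg (+-nonneg
        (p≤q⇒0≤q-p (⁻¹-lipschitz (half-difference-positive a≤x) (hd.monotone 1≤x x≤y) (1≤hd*3 a≤x)))
        (*-nonneg (nonNegative⁻¹ 18ℚ) (p≤q⇒0≤q-p (hd.lipschitz 1≤x x≤y))))
        (*-nonneg (nonNegative⁻¹ 10ℚ) (p≤q⇒0≤q-p (hd.monotone 1≤x x≤y)))))
      (solve 6 (λ x y v w v′ w′ → con ½ :*
           (con 3ℚ :* con 3ℚ :* (w :- v) :- (v′ :- w′)
             :+ con 18ℚ :* (v :+ con 1ℚ :* (y :- x) :- w) :+ con 10ℚ :* (w :- v))
         := x :- con ½ :* (v :+ v′) :+ con 10ℚ :* (y :- x) :- (y :- con ½ :* (w :+ w′)))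
       refl x y (hd x) (hd y) (hd x ⁻¹) (hd y ⁻¹))
  ; growth    = λ {x} a≤x → ≤-by-difference
      (+-nonneg (p≤q⇒0≤q-p (<⇒≤ (half-difference<id (<-≤-trans 0<1 (≤-trans 1≤7/5 a≤x)))))
                (p≤q⇒0≤q-p (⁻¹-upper (half-difference-positive a≤x) (1≤hd*3 a≤x))))
      (solve 3 (λ x v v′ → x :- v :+ (con 3ℚ :- v′)
         := con 3ℚ :+ (x :- con ½ :* (v :+ v′) :+ (x :- con ½ :* (v :+ v′))) :- x)
       refl x (hd x) (hd x ⁻¹))
  }
  where
  hd = half-difference
  module hd = Climbing half-difference-climbing
  -- 3 bounds 1 / w for w ≥ half-difference 7/5 = 12/35.
  3ℚ 10ℚ 18ℚ : ℚ
  3ℚ = + 3 / 1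
  10ℚ = + 10 / 1
  18ℚ = + 18 / 1
  1≤hd*3 : 7/5 ≤ x → 1ℚ ≤ hd x * 3ℚ
  1≤hd*3 a≤x = ≤-trans (toWitness {a? = 1ℚ ≤? hd 7/5 * 3ℚ} _)
    (*-monoʳ-≤-nonNeg 3ℚ (half-difference-7/5≤ a≤x))

-- Irrationality of the square root of two.

-- Infinite descent: an even square has an even root, so m and then n can be halved. The bound
-- `fuel` on m makes the recursion structural.
√2-irrational : ∀ m n → m ℕ.* m ≡ 2 ℕ.* (n ℕ.* n) → n ≡ 0
√2-irrational m = descend m m ℕ.≤-refl
  where
  halve : ∀ m n → m ℕ.* m ≡ 2 ℕ.* n → ∃[ k ] m ≡ k ℕ.* 2 × n ≡ 2 ℕ.* (k ℕ.* k)
  halve m n m²≡2n = k , m≡k*2 , ℕ.*-cancelˡ-≡ n (2 ℕ.* (k ℕ.* k)) 2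
      (trans (sym m²≡2n) (trans (cong (λ i → i ℕ.* i) m≡k*2) (square k)))
    where
    2∣m : 2 ℕ.∣ m
    2∣m = reduce (ℕ.euclidsLemma m m ℕ.prime[2] (ℕ.divides n (trans m²≡2n (ℕ.*-comm 2 n))))
    k = ℕ.quotient 2∣m
    m≡k*2 = ℕ._∣_.equality 2∣m
    square : ∀ k → (k ℕ.* 2) ℕ.* (k ℕ.* 2) ≡ 2 ℕ.* (2 ℕ.* (k ℕ.* k))
    square = ℕ.solve-∀

  descend : ∀ fuel m → m ℕ.≤ fuel → ∀ n → m ℕ.* m ≡ 2 ℕ.* (n ℕ.* n) → n ≡ 0
  descend _ zero _ n eq = reduce (ℕ.m*n≡0⇒m≡0∨n≡0 n (ℕ.*-cancelˡ-≡ (n ℕ.* n) 0 2 (sym eq)))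
  descend (suc fuel) m@(suc _) m≤1+fuel n eq =
    let k , m≡k*2 , n²≡2k² = halve m (n ℕ.* n) eq
        l , n≡l*2 , k²≡2l² = halve n (k ℕ.* k) n²≡2k²
        k≤fuel = ℕ.s≤s⁻¹ (ℕ.≤-trans (k<m k m m≡k*2) m≤1+fuel)
    in trans n≡l*2 (cong (ℕ._* 2) (descend fuel k k≤fuel l k²≡2l²))
    where
    k<m : ∀ k m → .{{ℕ.NonZero m}} → m ≡ k ℕ.* 2 → k ℕ.< m
    k<m (suc k) _ refl = ℕ.m<m*n (suc k) 2 (ℕ.s<s ℕ.z<s)

-- Rationals as ratios of integers.

-- A record rather than a synonym, so that i and j can be inferred from x ≈ i ∶ j.
infix 4 _≈_∶_
record _≈_∶_ (x : ℚ) (i j : ℤ) : Set where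
  constructor ratio
  field cross : x * ι j ≡ ι i
open _≈_∶_

ι-2** : ∀ i j → ι (+ 2 ⊛ (i ⊛ j)) ≡ (1ℚ + 1ℚ) * (ι i * ι j)
ι-2** i j = trans (ι-* (+ 2) (i ⊛ j)) (cong (ι (+ 2) *_) (ι-* i j))

⁻¹-∶ : ∀ {i j} → 0ℚ < x → x ≈ i ∶ j → x ⁻¹ ≈ j ∶ i
⁻¹-∶ {x} {i} {j} 0<x (ratio x≈) = ratio (begin
  x ⁻¹ * ι i        ≡⟨ cong (x ⁻¹ *_) x≈ ⟨
  x ⁻¹ * (x * ι j)  ≡⟨ *-assoc (x ⁻¹) x (ι j) ⟨
  x ⁻¹ * x * ι j    ≡⟨ cong (_* ι j) (⁻¹-inverseˡ 0<x) ⟩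
  1ℚ * ι j          ≡⟨ *-identityˡ (ι j) ⟩
  ι j               ∎)
  where open ≡-Reasoning

-- `k` and `l` are given by equations so that opaque variables can stand for the polynomials, as in
-- the parametrisation below.
half-difference-∶ : ∀ {i j k l} → 0ℚ < x → x ≈ i ∶ j →
  k ≡ i ⊛ i ⊖ j ⊛ j → l ≡ + 2 ⊛ (i ⊛ j) → half-difference x ≈ k ∶ l
half-difference-∶ {x} {i} {j} 0<x (ratio x≈) refl refl = ratio (begin
  half-difference x * ι (+ 2 ⊛ (i ⊛ j))  ≡⟨ cong (half-difference x *_) (ι-2** i j) ⟩
  half-difference x * ((1ℚ + 1ℚ) * (ι i * ι j))
    ≡⟨ solve 4 (λ x x′ a b → con ½ :* (x :- x′) :* ((con 1ℚ :+ con 1ℚ) :* (a :* b))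
         := a :* (x :* b) :- b :* (x′ :* a))
       refl x (x ⁻¹) (ι i) (ι j) ⟩
  ι i * (x * ι j) - ι j * (x ⁻¹ * ι i)
    ≡⟨ cong₂ (λ u v → ι i * u - ι j * v) x≈ (cross (⁻¹-∶ {i = i} {j} 0<x (ratio x≈))) ⟩
  ι i * ι i - ι j * ι j                  ≡⟨ cong₂ _-_ (ι-* i i) (ι-* j j) ⟨
  ι (i ⊛ i) - ι (j ⊛ j)                  ≡⟨ cong (λ v → ι (i ⊛ i) + v) (ι-neg (j ⊛ j)) ⟨
  ι (i ⊛ i) + ι (ℤ.- (j ⊛ j))            ≡⟨ ι-+ (i ⊛ i) (ℤ.- (j ⊛ j)) ⟨
  ι (i ⊛ i ⊖ j ⊛ j)                      ∎)
  where open ≡-Reasoning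

half-sum-∶ : ∀ {i j k l} → 0ℚ < x → x ≈ i ∶ j →
  k ≡ i ⊛ i ⊕ j ⊛ j → l ≡ + 2 ⊛ (i ⊛ j) → half-sum x ≈ k ∶ l
half-sum-∶ {x} {i} {j} 0<x (ratio x≈) refl refl = ratio (begin
  half-sum x * ι (+ 2 ⊛ (i ⊛ j))  ≡⟨ cong (half-sum x *_) (ι-2** i j) ⟩
  half-sum x * ((1ℚ + 1ℚ) * (ι i * ι j))
    ≡⟨ solve 4 (λ x x′ a b → con ½ :* (x :+ x′) :* ((con 1ℚ :+ con 1ℚ) :* (a :* b))
         := a :* (x :* b) :+ b :* (x′ :* a))
       refl x (x ⁻¹) (ι i) (ι j) ⟩
  ι i * (x * ι j) + ι j * (x ⁻¹ * ι i)
    ≡⟨ cong₂ (λ u v → ι i * u + ι j * v) x≈ (cross (⁻¹-∶ {i = i} {j} 0<x (ratio x≈))) ⟩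
  ι i * ι i + ι j * ι j           ≡⟨ cong₂ _+_ (ι-* i i) (ι-* j j) ⟨
  ι (i ⊛ i) + ι (j ⊛ j)           ≡⟨ ι-+ (i ⊛ i) (j ⊛ j) ⟨
  ι (i ⊛ i ⊕ j ⊛ j)               ∎)
  where open ≡-Reasoning

-‿∶ : ∀ {i j k} → x ≈ i ∶ k → y ≈ j ∶ k → x - y ≈ i ⊖ j ∶ k
-‿∶ {x} {y} {i} {j} {k} (ratio x≈) (ratio y≈) = ratio (begin
  (x - y) * ι k      ≡⟨ solve 3 (λ x y k → (x :- y) :* k := x :* k :- y :* k) refl x y (ι k) ⟩
  x * ι k - y * ι k  ≡⟨ cong₂ _-_ x≈ y≈ ⟩
  ι i - ι j          ≡⟨ cong (λ v → ι i + v) (ι-neg j) ⟨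
  ι i + ι (ℤ.- j)    ≡⟨ ι-+ i (ℤ.- j) ⟨
  ι (i ⊖ j)          ∎)
  where open ≡-Reasoning

scale-∶ : ∀ {i j} k → x ≈ i ∶ j → x ≈ i ⊛ k ∶ j ⊛ k
scale-∶ {x} {i} {j} k (ratio x≈) = ratio (begin
  x * ι (j ⊛ k)    ≡⟨ cong (x *_) (ι-* j k) ⟩
  x * (ι j * ι k)  ≡⟨ *-assoc x (ι j) (ι k) ⟨
  x * ι j * ι k    ≡⟨ cong (_* ι k) x≈ ⟩
  ι i * ι k        ≡⟨ ι-* i k ⟨
  ι (i ⊛ k)        ∎)
  where open ≡-Reasoning

∶-positive : ∀ {i j} → 0ℚ < x → x ≈ i ∶ j → 0ℤ ℤ.< j → 0ℤ ℤ.< i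
∶-positive {j = j} 0<x (ratio x≈) 0<j = ι-cancel-< (subst (0ℚ <_) x≈ (*-pos 0<x (ι-mono-< 0<j)))

self-∶ : ∀ x → x ≈ ↥ x ∶ ↧ x
self-∶ x = subst (λ y → y ≈ ↥ x ∶ ↧ x) (↥p/↧p≡p x) (ratio ([i/n]*ιn≡ιi (↥ x) (↧ₙ x)))

∶⇒≡/ : ∀ i n .{{_ : ℕ.NonZero n}} → x ≈ i ∶ + n → x ≡ i / n
∶⇒≡/ {x} i n (ratio x≈) = begin
  x                               ≡⟨ undo x ⟨
  x * ι (+ n) * ι (+ n) ⁻¹        ≡⟨ cong (_* ι (+ n) ⁻¹) (trans x≈ (sym ([i/n]*ιn≡ιi i n))) ⟩
  (i / n) * ι (+ n) * ι (+ n) ⁻¹  ≡⟨ undo (i / n) ⟩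
  i / n                           ∎
  where
  open ≡-Reasoning
  undo : ∀ x → x * ι (+ n) * ι (+ n) ⁻¹ ≡ x
  undo x = trans (*-assoc x (ι (+ n)) (ι (+ n) ⁻¹))
    (trans (cong (x *_) (⁻¹-inverseʳ (ι-mono-< (ℤ.+<+ (ℕ.>-nonZero⁻¹ n))))) (*-identityʳ x))

-- Cubes of squares and their parametrisation.

ℤ-*-pos : ∀ {i j} → 0ℤ ℤ.< i → 0ℤ ℤ.< j → 0ℤ ℤ.< i ⊛ j
ℤ-*-pos {i} {j} 0<i 0<j = subst (ℤ._< i ⊛ j) (ℤ.*-zeroˡ j) (ℤ.*-monoʳ-<-pos j {{ℤ.positive 0<j}} 0<i)

-- The coefficient i + j merges the two equal edges, so the eight vertices form two three-term
-- progressions with common step `d`.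
record Cube (α β : ℚ) : Set where
  field
    a₀ d e : ℕ
    a₀>0 : ℕ.NonZero a₀
    d>0  : ℕ.NonZero d
    e>0  : ℕ.NonZero e
    squares : ∀ (i j k : Fin 2) → a₀ ℕ.+ (toℕ i ℕ.+ toℕ j) ℕ.* d ℕ.+ toℕ k ℕ.* e U.∈ 𝒮
    a₀∶d : α ≈ + a₀ ∶ + d
    e∶d  : β ≈ + e ∶ + d

square-∈ : ∀ n z → + n ≡ z ⊛ z → n U.∈ 𝒮
square-∈ n z n≡z² = ℤ.∣ z ∣ , (begin
  n                    ≡⟨ cong ℤ.∣_∣ n≡z² ⟩
  ℤ.∣ z ⊛ z ∣          ≡⟨ ℤ.abs-* z z ⟩
  ℤ.∣ z ∣ ℕ.* ℤ.∣ z ∣  ≡⟨ cong (ℤ.∣ z ∣ ℕ.*_) (ℕ.*-identityʳ ℤ.∣ z ∣) ⟨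
  ℤ.∣ z ∣ ℕ.^ 2        ∎)
  where open ≡-Reasoning

+∣z²∣≡z² : ∀ z → + (ℤ.∣ z ∣ ℕ.* ℤ.∣ z ∣) ≡ z ⊛ z
+∣z²∣≡z² (+ n) = ℤ.pos-* n n
+∣z²∣≡z² -[1+ n ] = refl

+∣_∣≡ : ∀ {i} → 0ℤ ℤ.< i → + ℤ.∣ i ∣ ≡ i
+∣ 0<i ∣≡ = ℤ.0≤i⇒+∣i∣≡i (ℤ.<⇒≤ 0<i)

pos⇒nonZero∣∣ : ∀ {i} → 0ℤ ℤ.< i → ℕ.NonZero ℤ.∣ i ∣
pos⇒nonZero∣∣ {+[1+ _ ]} _ = _
pos⇒nonZero∣∣ {+0} (ℤ.+<+ ())

pos-linear : ∀ a x d y e → + (a ℕ.+ x ℕ.* d ℕ.+ y ℕ.* e) ≡ + a ⊕ + x ⊛ + d ⊕ + y ⊛ + e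
pos-linear a x d y e = cong₂ (λ i j → + a ⊕ i ⊕ j) (ℤ.pos-* x d) (ℤ.pos-* y e)

i²≢2j² : ∀ z d → 0ℤ ℤ.< d → z ⊛ z ≢ + 2 ⊛ (d ⊛ d)
i²≢2j² z d 0<d eq = ℤ.<⇒≢ 0<d (sym (ℤ.∣i∣≡0⇒i≡0 (√2-irrational ℤ.∣ z ∣ ℤ.∣ d ∣ (begin
  ℤ.∣ z ∣ ℕ.* ℤ.∣ z ∣          ≡⟨ ℤ.abs-* z z ⟨
  ℤ.∣ z ⊛ z ∣                  ≡⟨ cong ℤ.∣_∣ eq ⟩
  ℤ.∣ + 2 ⊛ (d ⊛ d) ∣          ≡⟨ ℤ.abs-* (+ 2) (d ⊛ d) ⟩
  2 ℕ.* ℤ.∣ d ⊛ d ∣            ≡⟨ cong (2 ℕ.*_) (ℤ.abs-* d d) ⟩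
  2 ℕ.* (ℤ.∣ d ∣ ℕ.* ℤ.∣ d ∣)  ∎))))
  where open ≡-Reasoning

-- In the parametrisation below these four signs make `M`, `A`, `P` and `E` positive, and with them
-- all the denominators.
Admissible : ℚ → Set
Admissible t = let v = half-difference t; s = half-sum v in
  0ℚ < t × 0ℚ < v × 0ℚ < half-difference s × 0ℚ < gap s

-- Since 4XP = (2KC)², multiplying the squares X , X ± d by 4XP keeps them
-- squares and turns the step d into D.  The intermediate quantities are
-- variables constrained by equations because unfolding the nested
-- polynomials is infeasible.
module Parametrisation
  (M N A B X d P Q D E : ℤ)
  (A≡ : A ≡ M ⊛ M ⊖ N ⊛ N) (B≡ : B ≡ + 2 ⊛ (M ⊛ N))
  (X≡ : X ≡ A ⊛ A ⊕ B ⊛ B) (d≡ : d ≡ + 2 ⊛ (A ⊛ B))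
  (P≡ : P ≡ X ⊛ X ⊖ d ⊛ d) (Q≡ : Q ≡ + 2 ⊛ (X ⊛ d))
  (D≡ : D ≡ + 2 ⊛ (P ⊛ Q)) (E≡ : E ≡ X ⊛ (+ 4 ⊛ X ⊛ P) ⊖ (P ⊛ P ⊕ Q ⊛ Q))
  where

  4XP*d≡D : d ⊛ (+ 4 ⊛ X ⊛ P) ≡ D
  4XP*d≡D = trans (lemma X d P) (sym (trans D≡ (cong (λ q → + 2 ⊛ (P ⊛ q)) Q≡)))
    where
    lemma : ∀ X d P → d ⊛ (+ 4 ⊛ X ⊛ P) ≡ + 2 ⊛ (P ⊛ (+ 2 ⊛ (X ⊛ d)))
    lemma = ℤ.solve-∀

  -- The bottom progression has middle term P² + Q² and step D; this is its first term.
  [P-Q]² : P ⊛ P ⊕ Q ⊛ Q ⊖ D ≡ (P ⊖ Q) ⊛ (P ⊖ Q)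
  [P-Q]² = trans (cong (P ⊛ P ⊕ Q ⊛ Q ⊖_) D≡) (lemma P Q)
    where
    lemma : ∀ P Q → P ⊛ P ⊕ Q ⊛ Q ⊖ + 2 ⊛ (P ⊛ Q) ≡ (P ⊖ Q) ⊛ (P ⊖ Q)
    lemma = ℤ.solve-∀

  -- P - Q = (X - d)² - 2d² vanishes only if √2 is rational.
  P-Q≢0 : 0ℤ ℤ.< d → P ⊖ Q ≢ 0ℤ
  P-Q≢0 0<d P-Q≡0 = i²≢2j² (X ⊖ d) d 0<d (ℤ.i-j≡0⇒i≡j _ _
    (trans (lemma X d) (trans (sym (cong₂ _⊖_ P≡ Q≡)) P-Q≡0)))
    where
    lemma : ∀ X d → (X ⊖ d) ⊛ (X ⊖ d) ⊖ + 2 ⊛ (d ⊛ d) ≡ X ⊛ X ⊖ d ⊛ d ⊖ + 2 ⊛ (X ⊛ d)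
    lemma = ℤ.solve-∀

  private
    -- Square roots of `P` and `X`: `C` is the hypotenuse of the triangle with legs `A` and `B`, and
    -- (A² + B²)² - (2AB)² = (A² - B²)².
    K C : ℤ
    K = A ⊛ A ⊖ B ⊛ B
    C = M ⊛ M ⊕ N ⊛ N

    X≡C² : X ≡ C ⊛ C
    X≡C² = trans X≡ (trans (cong₂ (λ a b → a ⊛ a ⊕ b ⊛ b) A≡ B≡) (lemma M N))
      where
      lemma : ∀ M N → (M ⊛ M ⊖ N ⊛ N) ⊛ (M ⊛ M ⊖ N ⊛ N) ⊕ + 2 ⊛ (M ⊛ N) ⊛ (+ 2 ⊛ (M ⊛ N))
        ≡ (M ⊛ M ⊕ N ⊛ N) ⊛ (M ⊛ M ⊕ N ⊛ N)
      lemma = ℤ.solve-∀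

    P≡K² : P ≡ K ⊛ K
    P≡K² = trans P≡ (trans (cong₂ (λ x y → x ⊛ x ⊖ y ⊛ y) X≡ d≡) (lemma A B))
      where
      lemma : ∀ A B → (A ⊛ A ⊕ B ⊛ B) ⊛ (A ⊛ A ⊕ B ⊛ B) ⊖ + 2 ⊛ (A ⊛ B) ⊛ (+ 2 ⊛ (A ⊛ B))
        ≡ (A ⊛ A ⊖ B ⊛ B) ⊛ (A ⊛ A ⊖ B ⊛ B)
      lemma = ℤ.solve-∀

  vertex : ℤ → ℤ → ℤ
  vertex x y = (P ⊖ Q) ⊛ (P ⊖ Q) ⊕ x ⊛ D ⊕ y ⊛ E

  private
    lower-face : ∀ x {z} → (P ⊖ Q) ⊛ (P ⊖ Q) ⊕ x ⊛ (+ 2 ⊛ (P ⊛ Q)) ≡ z → vertex x (+ 0) ≡ z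
    lower-face x {z} eq = begin
      (P ⊖ Q) ⊛ (P ⊖ Q) ⊕ x ⊛ D ⊕ + 0 ⊛ E      ≡⟨ cong ((P ⊖ Q) ⊛ (P ⊖ Q) ⊕ x ⊛ D ⊕_) (ℤ.*-zeroˡ E) ⟩
      (P ⊖ Q) ⊛ (P ⊖ Q) ⊕ x ⊛ D ⊕ + 0          ≡⟨ ℤ.+-identityʳ _ ⟩
      (P ⊖ Q) ⊛ (P ⊖ Q) ⊕ x ⊛ D                ≡⟨ cong (λ D → (P ⊖ Q) ⊛ (P ⊖ Q) ⊕ x ⊛ D) D≡ ⟩
      (P ⊖ Q) ⊛ (P ⊖ Q) ⊕ x ⊛ (+ 2 ⊛ (P ⊛ Q))  ≡⟨ eq ⟩
      z                                        ∎
      where open ≡-Reasoning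

    lower₀ : ∀ P Q → (P ⊖ Q) ⊛ (P ⊖ Q) ⊕ + 0 ⊛ (+ 2 ⊛ (P ⊛ Q)) ≡ (P ⊖ Q) ⊛ (P ⊖ Q)
    lower₀ = ℤ.solve-∀

    -- `P` and `Q` are the legs of the Pythagorean triangle generated by `X` and `d`, whose
    -- hypotenuse is X² + d².
    lower₁ : (P ⊖ Q) ⊛ (P ⊖ Q) ⊕ + 1 ⊛ (+ 2 ⊛ (P ⊛ Q)) ≡ (X ⊛ X ⊕ d ⊛ d) ⊛ (X ⊛ X ⊕ d ⊛ d)
    lower₁ = trans (cong₂ (λ P Q → (P ⊖ Q) ⊛ (P ⊖ Q) ⊕ + 1 ⊛ (+ 2 ⊛ (P ⊛ Q))) P≡ Q≡) (lemma X d)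
      where
      lemma : ∀ X d →
        (X ⊛ X ⊖ d ⊛ d ⊖ + 2 ⊛ (X ⊛ d)) ⊛ (X ⊛ X ⊖ d ⊛ d ⊖ + 2 ⊛ (X ⊛ d))
          ⊕ + 1 ⊛ (+ 2 ⊛ ((X ⊛ X ⊖ d ⊛ d) ⊛ (+ 2 ⊛ (X ⊛ d))))
        ≡ (X ⊛ X ⊕ d ⊛ d) ⊛ (X ⊛ X ⊕ d ⊛ d)
      lemma = ℤ.solve-∀

    lower₂ : ∀ P Q → (P ⊖ Q) ⊛ (P ⊖ Q) ⊕ + 2 ⊛ (+ 2 ⊛ (P ⊛ Q)) ≡ (P ⊕ Q) ⊛ (P ⊕ Q)
    lower₂ = ℤ.solve-∀

    -- `E` is the difference of the middle terms 4X²P and P² + Q², so adding it carries the bottom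
    -- progression to 4XP times X - d, X, X + d. The shift x - 1 arises because `X` is the middle
    -- term.
    upper-face : ∀ x {L} → X ⊕ (x ⊖ + 1) ⊛ d ≡ L ⊛ L →
      vertex x (+ 1) ≡ + 2 ⊛ K ⊛ C ⊛ L ⊛ (+ 2 ⊛ K ⊛ C ⊛ L)
    upper-face x {L} eq = begin
      vertex x (+ 1)                             ≡⟨ cong₂ (λ D E → (P ⊖ Q) ⊛ (P ⊖ Q) ⊕ x ⊛ D ⊕ + 1 ⊛ E) D≡ E≡ ⟩
      (P ⊖ Q) ⊛ (P ⊖ Q) ⊕ x ⊛ (+ 2 ⊛ (P ⊛ Q)) ⊕ + 1 ⊛ (X ⊛ (+ 4 ⊛ X ⊛ P) ⊖ (P ⊛ P ⊕ Q ⊛ Q))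
                                                  ≡⟨ collect X P Q x ⟩
      + 4 ⊛ P ⊛ X ⊛ X ⊕ (x ⊖ + 1) ⊛ P ⊛ + 2 ⊛ Q  ≡⟨ cong (λ Q → + 4 ⊛ P ⊛ X ⊛ X ⊕ (x ⊖ + 1) ⊛ P ⊛ + 2 ⊛ Q) Q≡ ⟩
      + 4 ⊛ P ⊛ X ⊛ X ⊕ (x ⊖ + 1) ⊛ P ⊛ + 2 ⊛ (+ 2 ⊛ (X ⊛ d))
                                                  ≡⟨ factor X d P x ⟩
      + 4 ⊛ P ⊛ X ⊛ (X ⊕ (x ⊖ + 1) ⊛ d)          ≡⟨ cong₂ (λ p z → + 4 ⊛ p ⊛ X ⊛ z) P≡K² eq ⟩
      + 4 ⊛ (K ⊛ K) ⊛ X ⊛ (L ⊛ L)                ≡⟨ cong (λ z → + 4 ⊛ (K ⊛ K) ⊛ z ⊛ (L ⊛ L)) X≡C² ⟩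
      + 4 ⊛ (K ⊛ K) ⊛ (C ⊛ C) ⊛ (L ⊛ L)          ≡⟨ as-square K C L ⟩
      + 2 ⊛ K ⊛ C ⊛ L ⊛ (+ 2 ⊛ K ⊛ C ⊛ L)        ∎
      where
      open ≡-Reasoning
      collect : ∀ X P Q x →
        (P ⊖ Q) ⊛ (P ⊖ Q) ⊕ x ⊛ (+ 2 ⊛ (P ⊛ Q)) ⊕ + 1 ⊛ (X ⊛ (+ 4 ⊛ X ⊛ P) ⊖ (P ⊛ P ⊕ Q ⊛ Q))
          ≡ + 4 ⊛ P ⊛ X ⊛ X ⊕ (x ⊖ + 1) ⊛ P ⊛ + 2 ⊛ Q
      collect = ℤ.solve-∀
      factor : ∀ X d P x → + 4 ⊛ P ⊛ X ⊛ X ⊕ (x ⊖ + 1) ⊛ P ⊛ + 2 ⊛ (+ 2 ⊛ (X ⊛ d))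
        ≡ + 4 ⊛ P ⊛ X ⊛ (X ⊕ (x ⊖ + 1) ⊛ d)
      factor = ℤ.solve-∀
      as-square : ∀ K C L → + 4 ⊛ (K ⊛ K) ⊛ (C ⊛ C) ⊛ (L ⊛ L) ≡ + 2 ⊛ K ⊛ C ⊛ L ⊛ (+ 2 ⊛ K ⊛ C ⊛ L)
      as-square = ℤ.solve-∀

    X-d≡[A-B]² : X ⊕ (+ 0 ⊖ + 1) ⊛ d ≡ (A ⊖ B) ⊛ (A ⊖ B)
    X-d≡[A-B]² = trans (cong₂ (λ x y → x ⊕ (+ 0 ⊖ + 1) ⊛ y) X≡ d≡) (lemma A B)
      where
      lemma : ∀ A B → A ⊛ A ⊕ B ⊛ B ⊕ (+ 0 ⊖ + 1) ⊛ (+ 2 ⊛ (A ⊛ B)) ≡ (A ⊖ B) ⊛ (A ⊖ B)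
      lemma = ℤ.solve-∀

    X+0≡C² : X ⊕ (+ 1 ⊖ + 1) ⊛ d ≡ C ⊛ C
    X+0≡C² = trans (cong (X ⊕_) (ℤ.*-zeroˡ d)) (trans (ℤ.+-identityʳ X) X≡C²)

    X+d≡[A+B]² : X ⊕ (+ 2 ⊖ + 1) ⊛ d ≡ (A ⊕ B) ⊛ (A ⊕ B)
    X+d≡[A+B]² = trans (cong₂ (λ x y → x ⊕ (+ 2 ⊖ + 1) ⊛ y) X≡ d≡) (lemma A B)
      where
      lemma : ∀ A B → A ⊛ A ⊕ B ⊛ B ⊕ (+ 2 ⊖ + 1) ⊛ (+ 2 ⊛ (A ⊛ B)) ≡ (A ⊕ B) ⊛ (A ⊕ B)
      lemma = ℤ.solve-∀

  vertex-square : ∀ (i j k : Fin 2) → ∃[ z ] vertex (+ (toℕ i ℕ.+ toℕ j)) (+ toℕ k) ≡ z ⊛ z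
  vertex-square 0F 0F 0F = P ⊖ Q , lower-face (+ 0) (lower₀ P Q)
  vertex-square 0F 1F 0F = X ⊛ X ⊕ d ⊛ d , lower-face (+ 1) lower₁
  vertex-square 1F 0F 0F = X ⊛ X ⊕ d ⊛ d , lower-face (+ 1) lower₁
  vertex-square 1F 1F 0F = P ⊕ Q , lower-face (+ 2) (lower₂ P Q)
  vertex-square 0F 0F 1F = + 2 ⊛ K ⊛ C ⊛ (A ⊖ B) , upper-face (+ 0) X-d≡[A-B]²
  vertex-square 0F 1F 1F = + 2 ⊛ K ⊛ C ⊛ C , upper-face (+ 1) X+0≡C²
  vertex-square 1F 0F 1F = + 2 ⊛ K ⊛ C ⊛ C , upper-face (+ 1) X+0≡C²
  vertex-square 1F 1F 1F = + 2 ⊛ K ⊛ C ⊛ (A ⊕ B) , upper-face (+ 2) X+d≡[A+B]²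

  module _ {t : ℚ} (admissible : Admissible t) (t∶ : t ≈ M ∶ N) (0<N : 0ℤ ℤ.< N) where

    private
      v s w : ℚ
      v = half-difference t
      s = half-sum v
      w = half-difference s
      0<t : 0ℚ < t
      0<t = proj₁ admissible
      0<v : 0ℚ < v
      0<v = proj₁ (proj₂ admissible)
      0<w : 0ℚ < w
      0<w = proj₁ (proj₂ (proj₂ admissible))
      0<gap : 0ℚ < gap s
      0<gap = proj₂ (proj₂ (proj₂ admissible))
      0<s : 0ℚ < s
      0<s = *-pos (positive⁻¹ ½) (+-pos 0<v (<⇒≤ (⁻¹-pos 0<v)))
      v∶ : v ≈ A ∶ B
      v∶ = half-difference-∶ 0<t t∶ A≡ B≡
      s∶ : s ≈ X ∶ d
      s∶ = half-sum-∶ 0<v v∶ X≡ d≡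
      w∶ : w ≈ P ∶ Q
      w∶ = half-difference-∶ 0<s s∶ P≡ Q≡
      half-sum-w∶ : half-sum w ≈ P ⊛ P ⊕ Q ⊛ Q ∶ D
      half-sum-w∶ = half-sum-∶ 0<w w∶ refl D≡
      1∶ : 1ℚ ≈ D ∶ D
      1∶ = ratio (*-identityˡ (ι D))
      α∶ : half-sum w - 1ℚ ≈ (P ⊖ Q) ⊛ (P ⊖ Q) ∶ D
      α∶ = subst (half-sum w - 1ℚ ≈_∶ D) [P-Q]² (-‿∶ half-sum-w∶ 1∶)
      β∶ : gap s ≈ E ∶ D
      -- Scaling X / d by 4XP brings `s` to the denominator `D` of `half-sum w`.
      β∶ = subst (gap s ≈_∶ D) (sym E≡)
        (-‿∶ (subst (s ≈ X ⊛ (+ 4 ⊛ X ⊛ P) ∶_) 4XP*d≡D (scale-∶ (+ 4 ⊛ X ⊛ P) s∶)) half-sum-w∶)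

      0<2ij : ∀ {i j k} → k ≡ + 2 ⊛ (i ⊛ j) → 0ℤ ℤ.< i → 0ℤ ℤ.< j → 0ℤ ℤ.< k
      0<2ij k≡ 0<i 0<j = subst (0ℤ ℤ.<_) (sym k≡) (ℤ-*-pos (ℤ.+<+ (ℕ.z<s {1})) (ℤ-*-pos 0<i 0<j))
      0<B : 0ℤ ℤ.< B
      0<B = 0<2ij B≡ (∶-positive 0<t t∶ 0<N) 0<N
      0<d : 0ℤ ℤ.< d
      0<d = 0<2ij d≡ (∶-positive 0<v v∶ 0<B) 0<B
      0<Q : 0ℤ ℤ.< Q
      0<Q = 0<2ij Q≡ (∶-positive 0<s s∶ 0<d) 0<d
      0<D : 0ℤ ℤ.< D
      0<D = 0<2ij D≡ (∶-positive 0<w w∶ 0<Q) 0<Q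
      0<E : 0ℤ ℤ.< E
      0<E = ∶-positive 0<gap β∶ 0<D

      a₀ : ℕ
      a₀ = ℤ.∣ P ⊖ Q ∣ ℕ.* ℤ.∣ P ⊖ Q ∣

    cube : Cube (half-sum w - 1ℚ) (gap s)
    cube = record
      { a₀      = a₀
      ; d       = ℤ.∣ D ∣
      ; e       = ℤ.∣ E ∣
      ; a₀>0    = ℕ.m*n≢0 _ _ {{∣P-Q∣≢0}} {{∣P-Q∣≢0}}
      ; d>0     = pos⇒nonZero∣∣ 0<D
      ; e>0     = pos⇒nonZero∣∣ 0<E
      ; squares = λ i j k → square-∈ _ (proj₁ (vertex-square i j k))
          (trans (pos-linear a₀ (toℕ i ℕ.+ toℕ j) ℤ.∣ D ∣ (toℕ k) ℤ.∣ E ∣)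
          (trans (cong₂ (λ x y → x ⊕ + toℕ k ⊛ y)
            (cong₂ (λ x y → x ⊕ + (toℕ i ℕ.+ toℕ j) ⊛ y) (+∣z²∣≡z² (P ⊖ Q)) +∣ 0<D ∣≡) +∣ 0<E ∣≡)
            (proj₂ (vertex-square i j k))))
      ; a₀∶d    = subst₂ (half-sum w - 1ℚ ≈_∶_) (sym (+∣z²∣≡z² (P ⊖ Q))) (sym +∣ 0<D ∣≡) α∶
      ; e∶d     = subst₂ (gap s ≈_∶_) (sym +∣ 0<E ∣≡) (sym +∣ 0<D ∣≡) β∶
      }
      where
      ∣P-Q∣≢0 : ℕ.NonZero ℤ.∣ P ⊖ Q ∣
      ∣P-Q∣≢0 = ℕ.≢-nonZero λ eq → P-Q≢0 0<d (ℤ.∣i∣≡0⇒i≡0 eq)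

cubeAt : ∀ t → Admissible t → let s = half-sum (half-difference t) in
  Cube (half-sum (half-difference s) - 1ℚ) (gap s)
-- The eight intermediate integers are determined by the eight `refl` equations.
cubeAt t admissible = Parametrisation.cube (↥ t) (↧ t) _ _ _ _ _ _ _ _
  refl refl refl refl refl refl refl refl admissible (self-∶ t) (ℤ.+<+ ℕ.z<s)

-- Placing each ratio in a prescribed interval.

half-sum≤id : 1ℚ ≤ x → half-sum x ≤ x
half-sum≤id {x} 1≤x = ≤-by-difference
  (½*-nonneg (p≤q⇒0≤q-p (≤-trans (1≤x⇒x⁻¹≤1 1≤x) 1≤x)))
  (solve 2 (λ x x′ → con ½ :* (x :- x′) := x :- con ½ :* (x :+ x′)) refl x (x ⁻¹))

abstract
  -- The outer search returns a whole interval of values v, which becomes the target of the inner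
  -- search for t.
  half-sum∘half-difference-attains : 1ℚ ≤ p → p < q → ∃[ t ] let v = half-difference t in
    0ℚ < t × 0ℚ < v × p < half-sum v × half-sum v < q
  half-sum∘half-difference-attains 1≤p p<q =
    let l , r , 1≤l , l<r , p<hs<q   = attains half-sum-climbing 1≤p p<q
        -- `half-difference 1ℚ` computes to 0, so 0 ≤ l lets the search start at 1.
        t , u , 1≤t , t<u , l<hd<r = attains half-difference-climbing (≤-trans 0≤1 1≤l) l<r
        l<hd , hd<r = l<hd<r ≤-refl (<⇒≤ t<u)
    in t , <-≤-trans 0<1 1≤t , ≤-<-trans (≤-trans 0≤1 1≤l) l<hd , p<hs<q (<⇒≤ l<hd) (<⇒≤ hd<r)

-- The searches run inwards from s′ through w, s and v to t. As w ≥ 1, s′ = half-sum w ≤ w =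
-- half-difference s < s, which makes the gap positive.
a₀/d-attains : 1ℚ ≤ p → p < q →
  ∃[ t ] let s′ = half-sum (half-difference (half-sum (half-difference t))) in
  Admissible t × p < s′ × s′ < q
a₀/d-attains 1≤p p<q =
  let lw , rw , 1≤lw , lw<rw , p<s′<q = attains half-sum-climbing 1≤p p<q
      ls , rs , 1≤ls , ls<rs , lw<w<rw = attains half-difference-climbing (≤-trans 0≤1 1≤lw) lw<rw
      t , 0<t , 0<v , ls<s , s<rs = half-sum∘half-difference-attains 1≤ls ls<rs
      lw<w , w<rw = lw<w<rw (<⇒≤ ls<s) (<⇒≤ s<rs)
      1≤w = ≤-trans 1≤lw (<⇒≤ lw<w)
      s′<s = ≤-<-trans (half-sum≤id 1≤w) (half-difference<id (≤-<-trans (≤-trans 0≤1 1≤ls) ls<s))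
  in t , (0<t , 0<v , <-≤-trans 0<1 1≤w , p<q⇒0<q-p s′<s) , p<s′<q (<⇒≤ lw<w) (<⇒≤ w<rw)

-- The search for s starts at 7/5, where the gap is at most 0. Then s ≥ 7/5 makes w positive, and
-- the gap is positive because it exceeds p ≥ 0.
e/d-attains : 0ℚ ≤ p → p < q → ∃[ t ] let s = half-sum (half-difference t) in
  Admissible t × p < gap s × gap s < q
e/d-attains 0≤p p<q =
  let ls , rs , 7/5≤ls , ls<rs , p<gap<q =
        attains gap-climbing (≤-trans (toWitness {a? = gap 7/5 ≤? 0ℚ} _) 0≤p) p<q
      t , 0<t , 0<v , ls<s , s<rs = half-sum∘half-difference-attains (≤-trans 1≤7/5 7/5≤ls) ls<rs
      p<gap , gap<q = p<gap<q (<⇒≤ ls<s) (<⇒≤ s<rs)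
      0<w = half-difference-positive (≤-trans 7/5≤ls (<⇒≤ ls<s))
  in t , (0<t , 0<v , 0<w , ≤-<-trans 0≤p p<gap) , p<gap , gap<q

cubes-dense-a₀/d : 0ℚ ≤ p → p < q → ∃[ α ] ∃[ β ] Cube α β × p < α × α < q
cubes-dense-a₀/d {p} {q} 0≤p p<q =
  -- The ratio a₀ / d is s′ - 1, so the target interval is shifted by 1.
  at-parameter (a₀/d-attains (+-monoˡ-≤ 1ℚ 0≤p) (+-monoˡ-< 1ℚ p<q))
  where
  p+1-1≡p : ∀ p → p + 1ℚ - 1ℚ ≡ p
  p+1-1≡p = solve 1 (λ p → p :+ con 1ℚ :- con 1ℚ := p) refl
  at-parameter : _ → _
  at-parameter (t , admissible , p+1<s′ , s′<q+1) = _ , _ , cubeAt t admissible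
    , subst (_< _) (p+1-1≡p p) (+-monoˡ-< (- 1ℚ) p+1<s′)
    , subst (_ <_) (p+1-1≡p q) (+-monoˡ-< (- 1ℚ) s′<q+1)

cubes-dense-e/d : 0ℚ ≤ p → p < q → ∃[ α ] ∃[ β ] Cube α β × p < β × β < q
cubes-dense-e/d 0≤p p<q = at-parameter (e/d-attains 0≤p p<q)
  where
  at-parameter : _ → _
  at-parameter (t , admissible , p<gap , gap<q) = _ , _ , cubeAt t admissible , p<gap , gap<q

-- Orderings of the edges and the six index pairs.

module _ {α β} (c : Cube α β) where
  open Cube c

  dde : (a₀ ∷ d ∷ d ∷ e ∷ []) U.∈ 𝓗₊
  dde = (λ { 0F → a₀>0 ; 1F → d>0 ; 2F → d>0 ; 3F → e>0 })
      , λ { (i , j , k , refl) → subst 𝒮 (lemma a₀ d e (toℕ i) (toℕ j) (toℕ k)) (squares i j k) }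
    where
    lemma : ∀ a d e i j k → a ℕ.+ (i ℕ.+ j) ℕ.* d ℕ.+ k ℕ.* e ≡ a ℕ.+ i ℕ.* d ℕ.+ j ℕ.* d ℕ.+ k ℕ.* e
    lemma = ℕ.solve-∀

  edd : (a₀ ∷ e ∷ d ∷ d ∷ []) U.∈ 𝓗₊
  edd = (λ { 0F → a₀>0 ; 1F → e>0 ; 2F → d>0 ; 3F → d>0 })
      , λ { (k , i , j , refl) → subst 𝒮 (lemma a₀ d e (toℕ i) (toℕ j) (toℕ k)) (squares i j k) }
    where
    lemma : ∀ a d e i j k → a ℕ.+ (i ℕ.+ j) ℕ.* d ℕ.+ k ℕ.* e ≡ a ℕ.+ k ℕ.* e ℕ.+ i ℕ.* d ℕ.+ j ℕ.* d
    lemma = ℕ.solve-∀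

  ded : (a₀ ∷ d ∷ e ∷ d ∷ []) U.∈ 𝓗₊
  ded = (λ { 0F → a₀>0 ; 1F → d>0 ; 2F → e>0 ; 3F → d>0 })
      , λ { (i , k , j , refl) → subst 𝒮 (lemma a₀ d e (toℕ i) (toℕ j) (toℕ k)) (squares i j k) }
    where
    lemma : ∀ a d e i j k → a ℕ.+ (i ℕ.+ j) ℕ.* d ℕ.+ k ℕ.* e ≡ a ℕ.+ i ℕ.* d ℕ.+ k ℕ.* e ℕ.+ j ℕ.* d
    lemma = ℕ.solve-∀

  a₀/d : α ≡ (+ a₀ / d) {{d>0}}
  a₀/d = ∶⇒≡/ (+ a₀) d {{d>0}} a₀∶d

  e/d : β ≡ (+ e / d) {{d>0}}
  e/d = ∶⇒≡/ (+ e) d {{d>0}} e∶d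

ratios-dense : ∀ i j → i Fin.< j → 0ℚ ≤ p → p < q → ∃[ r ] r U.∈ H[ i , j ] × p < r × r < q
ratios-dense i j i<j 0≤p p<q = go i j i<j
  where
  via-α : ∀ {i j} → (∀ {α β} → Cube α β → α U.∈ H[ i , j ]) → ∃[ r ] r U.∈ H[ i , j ] × _ < r × r < _
  via-α f = let α , _ , c , p<α , α<q = cubes-dense-a₀/d 0≤p p<q in α , f c , p<α , α<q
  via-β : ∀ {i j} → (∀ {α β} → Cube α β → β U.∈ H[ i , j ]) → ∃[ r ] r U.∈ H[ i , j ] × _ < r × r < _
  via-β f = let _ , β , c , p<β , β<q = cubes-dense-e/d 0≤p p<q in β , f c , p<β , β<q
  go : ∀ i j → i Fin.< j → ∃[ r ] r U.∈ H[ i , j ] × _ < r × r < _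
  -- Each ordering puts `d` at index j; when i is positive it also puts `e` at index i.
  go 0F 1F _ = via-α λ c → _ , dde c , a₀/d c
  go 0F 2F _ = via-α λ c → _ , dde c , a₀/d c
  go 0F 3F _ = via-α λ c → _ , edd c , a₀/d c
  go 1F 2F _ = via-β λ c → _ , edd c , e/d c
  go 1F 3F _ = via-β λ c → _ , edd c , e/d c
  go 2F 3F _ = via-β λ c → _ , ded c , e/d c
  go 1F 1F (ℕ.s≤s ())
  go 2F 1F (ℕ.s≤s ())
  go 2F 2F (ℕ.s≤s (ℕ.s≤s ()))
  go 3F 1F (ℕ.s≤s ())
  go 3F 2F (ℕ.s≤s (ℕ.s≤s ()))
  go 3F 3F (ℕ.s≤s (ℕ.s≤s (ℕ.s≤s ())))

-- Density in the positive reals.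

ratio-positive : ∀ i j {r} → r U.∈ H[ i , j ] → 0ℚ < r
ratio-positive i j (a , (a≢0 , _) , refl) =
  positive⁻¹ _ {{normalize-pos (a i) (a j) {{a≢0 j}} {{a≢0 i}}}}

lower<upper : ∀ x {p q} → p U.∈ lower x → q U.∈ upper x → p < q
lower<upper x {p} {q} p∈ q∈ with <-cmp p q
... | tri< p<q _ _  = p<q
... | tri≈ _ refl _ = contradiction q∈ (disjoint x p∈)
... | tri> _ _ q<p  = contradiction q∈ (disjoint x (lower-closed x q<p p∈))

corollary1p8 : ∀ (i j : Fin 4) → i Fin.< j → DenseIn (inℝ H[ i , j ]) ℝ₊
corollary1p8 i j i<j = (λ {x} → ⊆ℝ₊ {x}) , meets
  where
  ⊆ℝ₊ : inℝ H[ i , j ] U.⊆ ℝ₊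
  ⊆ℝ₊ (r , r∈H , (_ , <r⇒∈lower) , _) =
    let b , 0<b , b<r = <-dense (ratio-positive i j r∈H) in b , 0<b , <r⇒∈lower b<r

  meets : (U : U.Pred ℝ _) → Open U → (∃[ x ] x U.∈ ℝ₊ × x U.∈ U) → ∃[ y ] y U.∈ inℝ H[ i , j ] × y U.∈ U
  meets U open-U (x , (b , 0<b , b∈) , x∈U) =
    let l , u , (a , a∈upper , a∈) , (c , c∈ , c∈lower) , within = open-U x∈U
        -- The left end `a` may be negative; the larger of `a` and the positive `b` is positive and
        -- still lies below x.
        p , a≤p , b≤p , p∈ = max a∈ b∈
        r , r∈H , p<r , r<c = ratios-dense i j i<j (≤-trans (<⇒≤ 0<b) b≤p) (lower<upper x p∈ c∈)
    in fromℚ r , (r , r∈H , ((λ q∈ → q∈) , (λ q∈ → q∈)) , (λ q∈ → q∈) , (λ q∈ → q∈))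
     , within (a , a∈upper , ≤-<-trans a≤p p<r) (c , r<c , c∈lower)
    where
    max : ∀ {a b} → a U.∈ lower x → b U.∈ lower x → ∃[ p ] a ≤ p × b ≤ p × p U.∈ lower x
    max {a} {b} a∈ b∈ with ≤-total a b
    ... | inj₁ a≤b = b , a≤b , ≤-refl , b∈
    ... | inj₂ b≤a = a , ≤-refl , b≤a , a∈
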